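{- Let $A_n=1$ if $n=2^{k+1}-2$ for some integer $k\ge0$ and $A_n=0$ otherwise, and let $D(n)=\det\left(A_{i+j}\right)_{i,j=0}^{n-1}$ for $n\ge1$, $D(0)=1$. Then for all $n\ge 0$, $$D(2n)=(-1)^{\binom{n}{2}}D(n),\qquad D(2n+1)=(-1)^{\binom{n+1}{2}}D(n).$$ -}

module Defs where

open import Data.Bool.Base using (if_then_else_)
open import Data.Fin.Base using (Fin; zero; suc; toℕ)
open import Data.Integer.Base using (ℤ; 0ℤ; 1ℤ; -1ℤ; _*_; _^_)
open import Data.Integer.Properties using (+-0-commutativeMonoid)
open import Algebra.Properties.CommutativeMonoid.Sum +-0-commutativeMonoid using (sum)
open import Data.Nat.Base as ℕ using (ℕ; zero; suc)
import Data.Nat.Properties as ℕ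
open import Data.Product.Base using (∃; _,_)
open import Data.Vec.Functional using (Vector; removeAt)
open import Relation.Binary.PropositionalEquality.Core using (_≡_; refl; cong)
open import Relation.Nullary.Decidable.Core using (Dec; does; map′)

-- Truncated subtraction agrees with subtraction here, since 2 ^ suc k ≥ 2.
IsSpecial : ℕ → Set
IsSpecial n = ∃ λ k → n ≡ 2 ℕ.^ suc k ℕ.∸ 2

k<2^k : ∀ k → k ℕ.< 2 ℕ.^ k
k<2^k zero    = ℕ.s≤s ℕ.z≤n
k<2^k (suc k) = ℕ.+-mono-≤ (ℕ.m^n>0 2 k) (ℕ.≤-trans (k<2^k k) (ℕ.m≤m+n _ 0))

k≤2^[1+k]∸2 : ∀ k → k ℕ.≤ 2 ℕ.^ suc k ℕ.∸ 2
k≤2^[1+k]∸2 k = begin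
  k                        ≤⟨ ℕ.m≤m+n k (k ℕ.+ 0) ⟩
  2 ℕ.* k                  ≡⟨ ℕ.m+n∸m≡n 2 (2 ℕ.* k) ⟨
  2 ℕ.+ 2 ℕ.* k ℕ.∸ 2      ≡⟨ cong (ℕ._∸ 2) (ℕ.*-suc 2 k) ⟨
  2 ℕ.* suc k ℕ.∸ 2        ≤⟨ ℕ.∸-monoˡ-≤ 2 (ℕ.*-monoʳ-≤ 2 (k<2^k k)) ⟩
  2 ℕ.^ suc k ℕ.∸ 2        ∎
  where open ℕ.≤-Reasoning

isSpecial? : ∀ n → Dec (IsSpecial n)
isSpecial? n = map′
  (λ { (k , _ , eq) → k , eq })
  (λ { (k , refl) → k , ℕ.s≤s (k≤2^[1+k]∸2 k) , refl })
  (ℕ.anyUpTo? (λ k → n ℕ.≟ 2 ℕ.^ suc k ℕ.∸ 2) (suc n))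

A : ℕ → ℤ
A n = if does (isSpecial? n) then 1ℤ else 0ℤ

Matrix : ℕ → Set
Matrix n = Vector (Vector ℤ n) n

submatrix : ∀ {n} → Matrix (suc n) → Fin (suc n) → Fin (suc n) → Matrix n
submatrix M i j r = removeAt (removeAt M i r) j

-- Laplace expansion along the first row; the empty determinant is 1.
det : ∀ {n} → Matrix n → ℤ
det {zero}  M = 1ℤ
det {suc n} M = sum λ j →
  -1ℤ ^ toℕ j * (M zero j * det (submatrix M zero j))

-- In particular D 0 reduces to 1ℤ.
D : ℕ → ℤ
D n = det {n} λ i j → A (toℕ i ℕ.+ toℕ j)

{-# OPTIONS --safe #-}
-- For q + m + 1 = 2 ^ k, each of the last q + 1 rows and each of the last q + 1
-- columns of the Hankel matrix of order 2q + 1 + m has a single nonzero entry,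
-- a 1 on the antidiagonal i + j = 2 (2 ^ k − 1). Expanding alternately along the
-- last row and the last column peels off that block and gives
-- D (2q + 1 + m) = (-1) ^ q D m. Every n ≥ 1 is of the form 2q + 1 + m, and then
-- so are 2n, with (2q, 2m + 1) for (q, m), and 2n + 1, with (2q + 1, 2m).
-- The theorem follows by strong induction on n.
module Submission where

open import Defs
open import Data.Bool.Base using (if_then_else_)
open import Data.Fin.Base using (Fin; zero; suc; toℕ; fromℕ<; punchIn; pinch)
open import Data.Fin.Properties using (punchInᵢ≢i; toℕ-fromℕ<; toℕ-injective; toℕ<n)
open import Data.Integer.Base using (ℤ; 0ℤ; 1ℤ; _+_; -1ℤ; _*_; _^_)
open import Data.Integer.Properties using (+-0-commutativeMonoid; +-*-semiring; *-zeroʳ; +-identityˡ; +-identityʳ; *-identityˡ; *-assoc; ^-distribˡ-+-*)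
open import Data.Integer.Tactic.RingSolver using (solve-∀)
open import Algebra.Properties.CommutativeMonoid.Sum +-0-commutativeMonoid using (sum; sum-cong-≗; sum-remove; sum-replicate-zero)
open import Algebra.Properties.Semiring.Sum +-*-semiring using (*-distribˡ-sum)
open import Data.Nat.Base as ℕ using (ℕ; zero; suc; _≤_; _<_; z≤n; s≤s)
import Data.Nat.Properties as ℕ
import Data.Nat.Tactic.RingSolver as ℕ
open import Data.Nat.Combinatorics using (_C_; nC1≡n; nCk+nC[k+1]≡[n+1]C[k+1])
open import Data.Nat.Induction using (<-rec)
open import Data.Product.Base using (_×_; _,_)
import Data.Sum.Base as Sum
open import Data.Sum.Base using (_⊎_; inj₁; inj₂)
open import Function.Base using (_∘_)
open import Relation.Binary.PropositionalEquality using (_≢_; refl; sym; trans; cong; cong₂; subst; module ≡-Reasoning)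
open import Relation.Nullary using (¬_)
open import Relation.Nullary.Decidable using (dec-true; dec-false)
open import Relation.Binary.PropositionalEquality.Core using (_≡_)

-- Signs and congruence of determinants.

sgn : ℕ → ℤ
sgn n = -1ℤ ^ n

sgn*sgn≡1 : ∀ n → sgn n * sgn n ≡ 1ℤ
sgn*sgn≡1 zero    = refl
sgn*sgn≡1 (suc n) = trans (square-neg (sgn n)) (sgn*sgn≡1 n)
  where
  square-neg : ∀ x → (-1ℤ * x) * (-1ℤ * x) ≡ x * x
  square-neg = solve-∀

sum-zero : ∀ {n} (t : Fin n → ℤ) → (∀ i → t i ≡ 0ℤ) → sum t ≡ 0ℤ
sum-zero {n} t t≡0 = trans (sum-cong-≗ t≡0) (sum-replicate-zero n)

det-cong : ∀ {n} {M N : Matrix n} → (∀ i j → M i j ≡ N i j) → det M ≡ det N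
det-cong {zero}  M≡N = refl
det-cong {suc n} M≡N = sum-cong-≗ λ j →
  cong (sgn (toℕ j) *_) (cong₂ _*_ (M≡N zero j) (det-cong λ r s → M≡N (suc r) (punchIn j s)))

-- After deleting punchIn c j, the index c sits at position pinch j c, and
-- deleting that one too leaves the same indices as deleting c and then j.

punchIn-pinch : ∀ {n} (c : Fin (suc n)) (j : Fin n) → punchIn (punchIn c j) (pinch j c) ≡ c
punchIn-pinch zero    zero    = refl
punchIn-pinch zero    (suc j) = refl
punchIn-pinch (suc c) zero    = refl
punchIn-pinch (suc c) (suc j) = cong suc (punchIn-pinch c j)

punchIn-punchIn-pinch : ∀ {n} (c : Fin (suc (suc n))) (j : Fin (suc n)) (x : Fin n) →
  punchIn (punchIn c j) (punchIn (pinch j c) x) ≡ punchIn c (punchIn j x)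
punchIn-punchIn-pinch zero    zero    x       = refl
punchIn-punchIn-pinch zero    (suc j) x       = refl
punchIn-punchIn-pinch (suc c) zero    x       = refl
punchIn-punchIn-pinch (suc c) (suc j) zero    = refl
punchIn-punchIn-pinch (suc c) (suc j) (suc x) = cong suc (punchIn-punchIn-pinch c j x)

-- The two positions sum to `c + j - 1` if `j < c` and to `c + j + 1` otherwise, so the parity flips
-- either way.
sgn-punchIn-pinch : ∀ {n} (c : Fin (suc n)) (j : Fin n) →
  sgn (toℕ (punchIn c j)) * sgn (toℕ (pinch j c)) ≡ -1ℤ * (sgn (toℕ c) * sgn (toℕ j))
sgn-punchIn-pinch zero    zero    = refl
sgn-punchIn-pinch zero    (suc j) = eq (sgn (toℕ j))
  where
  eq : ∀ y → (-1ℤ * (-1ℤ * y)) * 1ℤ ≡ -1ℤ * (1ℤ * (-1ℤ * y))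
  eq = solve-∀
sgn-punchIn-pinch (suc c) zero    = eq (sgn (toℕ c))
  where
  eq : ∀ x → 1ℤ * x ≡ -1ℤ * ((-1ℤ * x) * 1ℤ)
  eq = solve-∀
sgn-punchIn-pinch (suc c) (suc j) = begin
  (-1ℤ * sgn (toℕ (punchIn c j))) * (-1ℤ * sgn (toℕ (pinch j c)))
    ≡⟨ eq (sgn (toℕ (punchIn c j))) (sgn (toℕ (pinch j c))) ⟩
  sgn (toℕ (punchIn c j)) * sgn (toℕ (pinch j c))
    ≡⟨ sgn-punchIn-pinch c j ⟩
  -1ℤ * (sgn (toℕ c) * sgn (toℕ j))
    ≡⟨ cong (-1ℤ *_) (sym (eq (sgn (toℕ c)) (sgn (toℕ j)))) ⟩
  -1ℤ * ((-1ℤ * sgn (toℕ c)) * (-1ℤ * sgn (toℕ j))) ∎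
  where
  open ≡-Reasoning
  eq : ∀ x y → (-1ℤ * x) * (-1ℤ * y) ≡ x * y
  eq = solve-∀

-- Expansion along a row or column with at most one nonzero entry.

cofactorTerm : ∀ {n} → Matrix (suc n) → Fin (suc n) → Fin (suc n) → ℤ
cofactorTerm M r c = sgn (toℕ r) * (sgn (toℕ c) * (M r c * det (submatrix M r c)))

cofactorTerm-zero : ∀ {n} (M : Matrix (suc n)) r c → M r c ≡ 0ℤ → cofactorTerm M r c ≡ 0ℤ
cofactorTerm-zero M r c Mrc≡0 rewrite Mrc≡0 = eq (sgn (toℕ r)) (sgn (toℕ c)) (det (submatrix M r c))
  where
  eq : ∀ x y d → x * (y * (0ℤ * d)) ≡ 0ℤ
  eq = solve-∀

det-remove : ∀ {n} (M : Matrix (suc n)) c → det M ≡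
  sgn (toℕ c) * (M zero c * det (submatrix M zero c)) +
  sum λ j → sgn (toℕ (punchIn c j)) * (M zero (punchIn c j) * det (submatrix M zero (punchIn c j)))
det-remove M c = sum-remove {i = c} λ j → sgn (toℕ j) * (M zero j * det (submatrix M zero j))

-- Common induction step for rows and columns. After expansion along the first row, the term of
-- column `c` vanishes and every other minor expands at the entry `M (suc r) c`. Exchanging the two
-- column deletions leaves the first-row expansion of `submatrix M (suc r) c`, and the sign of the
-- exchange accounts for `suc r` in place of `r`.
det-step : ∀ {n} (M : Matrix (suc (suc n))) r c →
  M zero c * det (submatrix M zero c) ≡ 0ℤ →
  (∀ j → det (submatrix M zero (punchIn c j)) ≡ cofactorTerm (submatrix M zero (punchIn c j)) r (pinch j c)) →
  det M ≡ cofactorTerm M (suc r) c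
det-step M r c term≡0 expand = begin
  det M
    ≡⟨ det-remove M c ⟩
  sgn (toℕ c) * (M zero c * det (submatrix M zero c)) + sum t
    ≡⟨ cong (_+ sum t) (trans (cong (sgn (toℕ c) *_) term≡0) (*-zeroʳ (sgn (toℕ c)))) ⟩
  0ℤ + sum t
    ≡⟨ +-identityˡ (sum t) ⟩
  sum t
    ≡⟨ sum-cong-≗ t≡ ⟩
  sum (λ j → a * u j)
    ≡⟨ sym (*-distribˡ-sum a u) ⟩
  a * sum u
    ≡⟨ assoc (sgn (toℕ (suc r))) (sgn (toℕ c)) (M (suc r) c) (sum u) ⟩
  cofactorTerm M (suc r) c ∎
  where
  open ≡-Reasoning
  a = sgn (toℕ (suc r)) * sgn (toℕ c) * M (suc r) c
  t = λ j → sgn (toℕ (punchIn c j)) * (M zero (punchIn c j) * det (submatrix M zero (punchIn c j)))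
  u = λ j → sgn (toℕ j) * (M zero (punchIn c j) * det (submatrix (submatrix M (suc r) c) zero j))
  assoc : ∀ x y z w → x * y * z * w ≡ x * (y * (z * w))
  assoc = solve-∀
  shuffle₁ : ∀ x y z m e d → x * (m * (y * (z * (e * d)))) ≡ (x * z) * (y * (m * (e * d)))
  shuffle₁ = solve-∀
  shuffle₂ : ∀ x y z m e d → (-1ℤ * (z * x)) * (y * (m * (e * d))) ≡ -1ℤ * y * z * e * (x * (m * d))
  shuffle₂ = solve-∀
  t≡ : ∀ j → t j ≡ a * u j
  t≡ j = begin
    t j
      ≡⟨ cong (λ d → sgn (toℕ k) * (M zero k * d)) (expand j) ⟩
    sgn (toℕ k) * (M zero k * cofactorTerm (submatrix M zero k) r (pinch j c))
      ≡⟨ cong₂ (λ e d → sgn (toℕ k) * (M zero k * (sgn (toℕ r) * (sgn (toℕ (pinch j c)) * (e * d)))))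
           (cong (M (suc r)) (punchIn-pinch c j))
           (det-cong λ x y → cong (M (suc (punchIn r x))) (punchIn-punchIn-pinch c j y)) ⟩
    sgn (toℕ k) * (M zero k * (sgn (toℕ r) * (sgn (toℕ (pinch j c)) * (e * d))))
      ≡⟨ shuffle₁ (sgn (toℕ k)) (sgn (toℕ r)) (sgn (toℕ (pinch j c))) (M zero k) e d ⟩
    (sgn (toℕ k) * sgn (toℕ (pinch j c))) * (sgn (toℕ r) * (M zero k * (e * d)))
      ≡⟨ cong (_* (sgn (toℕ r) * (M zero k * (e * d)))) (sgn-punchIn-pinch c j) ⟩
    (-1ℤ * (sgn (toℕ c) * sgn (toℕ j))) * (sgn (toℕ r) * (M zero k * (e * d)))
      ≡⟨ shuffle₂ (sgn (toℕ j)) (sgn (toℕ r)) (sgn (toℕ c)) (M zero k) e d ⟩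
    a * u j ∎
    where
    k = punchIn c j
    e = M (suc r) c
    d = det (submatrix (submatrix M (suc r) c) zero j)

det-row : ∀ {n} (M : Matrix (suc n)) r c →
  (∀ j → M r (punchIn c j) ≡ 0ℤ) → det M ≡ cofactorTerm M r c
det-row M zero c row≡0 = begin
  det M
    ≡⟨ det-remove M c ⟩
  x + sum t
    ≡⟨ cong (x +_) (sum-zero t λ j →
         trans (cong (λ e → sgn (toℕ (punchIn c j)) * (e * det (submatrix M zero (punchIn c j)))) (row≡0 j))
               (*-zeroʳ (sgn (toℕ (punchIn c j))))) ⟩
  x + 0ℤ
    ≡⟨ +-identityʳ x ⟩
  x
    ≡⟨ *-identityˡ x ⟨
  cofactorTerm M zero c ∎
  where
  open ≡-Reasoning
  x = sgn (toℕ c) * (M zero c * det (submatrix M zero c))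
  t = λ j → sgn (toℕ (punchIn c j)) * (M zero (punchIn c j) * det (submatrix M zero (punchIn c j)))
det-row {suc n} M (suc r) c row≡0 = det-step M r c
  -- Without column `c`, row `r` of the minor is entirely zero, so its expansion at column `zero`
  -- vanishes.
  (trans (cong (M zero c *_)
           (trans (det-row (submatrix M zero c) r zero (λ j → row≡0 (suc j)))
                  (cofactorTerm-zero (submatrix M zero c) r zero (row≡0 zero))))
         (*-zeroʳ (M zero c)))
  (λ j → det-row (submatrix M zero (punchIn c j)) r (pinch j c)
    (λ x → trans (cong (M (suc r)) (punchIn-punchIn-pinch c j x)) (row≡0 (punchIn j x))))

-- Proved directly from first-row expansion, by induction on the order, rather than through the
-- determinant of the transpose.
det-column : ∀ {n} (M : Matrix (suc n)) r c →
  (∀ i → M (punchIn r i) c ≡ 0ℤ) → det M ≡ cofactorTerm M r c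
det-column {zero} M zero zero column≡0 = det-row M zero zero λ ()
det-column {suc n} M zero c column≡0 = begin
  det M
    ≡⟨ det-remove M c ⟩
  x + sum t
    ≡⟨ cong (x +_) (sum-zero t t≡0) ⟩
  x + 0ℤ
    ≡⟨ +-identityʳ x ⟩
  x
    ≡⟨ *-identityˡ x ⟨
  cofactorTerm M zero c ∎
  where
  open ≡-Reasoning
  x = sgn (toℕ c) * (M zero c * det (submatrix M zero c))
  t = λ j → sgn (toℕ (punchIn c j)) * (M zero (punchIn c j) * det (submatrix M zero (punchIn c j)))
  t≡0 : ∀ j → t j ≡ 0ℤ
  t≡0 j = trans (cong (λ d → sgn (toℕ k) * (M zero k * d)) minor≡0)
    (trans (cong (sgn (toℕ k) *_) (*-zeroʳ (M zero k))) (*-zeroʳ (sgn (toℕ k))))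
    where
    k = punchIn c j
    N = submatrix M zero k
    -- Column `c` survives in this minor at position `pinch j c`, and its only possibly nonzero
    -- entry was in the deleted row.
    minor-column≡0 : ∀ i → N i (pinch j c) ≡ 0ℤ
    minor-column≡0 i = trans (cong (M (suc i)) (punchIn-pinch c j)) (column≡0 i)
    minor≡0 : det N ≡ 0ℤ
    minor≡0 = trans (det-column N zero (pinch j c) (minor-column≡0 ∘ suc))
      (cofactorTerm-zero N zero (pinch j c) (minor-column≡0 zero))
det-column {suc n} M (suc r) c column≡0 = det-step M r c
  (cong (_* det (submatrix M zero c)) (column≡0 zero))
  (λ j → det-column (submatrix M zero (punchIn c j)) r (pinch j c)
    (λ i → trans (cong (M (suc (punchIn r i))) (punchIn-pinch c j)) (column≡0 (suc i))))

-- Determinants of arrays indexed by natural numbers.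

-- The counterpart of `punchIn` on natural numbers, so that positions in nested minors are governed
-- by inequalities alone.
skip : ℕ → ℕ → ℕ
skip zero    i       = suc i
skip (suc r) zero    = zero
skip (suc r) (suc i) = suc (skip r i)

toℕ-punchIn : ∀ {n} (r : Fin (suc n)) i → toℕ (punchIn r i) ≡ skip (toℕ r) (toℕ i)
toℕ-punchIn zero    i       = refl
toℕ-punchIn (suc r) zero    = refl
toℕ-punchIn (suc r) (suc i) = cong suc (toℕ-punchIn r i)

skip-< : ∀ {r i} → i < r → skip r i ≡ i
skip-< {suc r} {zero}  _         = refl
skip-< {suc r} {suc i} (s≤s i<r) = cong suc (skip-< i<r)

skip-≥ : ∀ {r i} → r ≤ i → skip r i ≡ suc i
skip-≥ {zero}          _         = refl
skip-≥ {suc r} {suc i} (s≤s r≤i) = cong suc (skip-≥ r≤i)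

skip≤suc : ∀ r i → skip r i ≤ suc i
skip≤suc zero    i       = ℕ.≤-refl
skip≤suc (suc r) zero    = z≤n
skip≤suc (suc r) (suc i) = s≤s (skip≤suc r i)

-- The entries come from one infinite array, so leading blocks of different orders share the same
-- `F`.
toMatrix : ∀ n → (ℕ → ℕ → ℤ) → Matrix n
toMatrix n F i j = F (toℕ i) (toℕ j)

detℕ : ∀ n → (ℕ → ℕ → ℤ) → ℤ
detℕ n F = det (toMatrix n F)

detℕ-cong : ∀ n {F G : ℕ → ℕ → ℤ} → (∀ i j → i < n → j < n → F i j ≡ G i j) → detℕ n F ≡ detℕ n G
detℕ-cong n F≡G = det-cong λ i j → F≡G (toℕ i) (toℕ j) (toℕ<n i) (toℕ<n j)

minorℕ : ℕ → ℕ → (ℕ → ℕ → ℤ) → ℕ → ℕ → ℤ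
minorℕ r c F i j = F (skip r i) (skip c j)

toℕ-punchIn-fromℕ< : ∀ {n r} (r≤n : r < suc n) (i : Fin n) → toℕ (punchIn (fromℕ< r≤n) i) ≡ skip r (toℕ i)
toℕ-punchIn-fromℕ< r≤n i =
  trans (toℕ-punchIn (fromℕ< r≤n) i) (cong (λ x → skip x (toℕ i)) (toℕ-fromℕ< r≤n))

cofactorTerm-fromℕ< : ∀ n F {r c} (r≤n : r < suc n) (c≤n : c < suc n) →
  cofactorTerm (toMatrix (suc n) F) (fromℕ< r≤n) (fromℕ< c≤n) ≡
  sgn r * (sgn c * (F r c * detℕ n (minorℕ r c F)))
cofactorTerm-fromℕ< n F r≤n c≤n = cong₂ _*_ (cong sgn (toℕ-fromℕ< r≤n))
  (cong₂ _*_ (cong sgn (toℕ-fromℕ< c≤n))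
    (cong₂ _*_ (cong₂ F (toℕ-fromℕ< r≤n) (toℕ-fromℕ< c≤n))
      (det-cong λ i j → cong₂ F (toℕ-punchIn-fromℕ< r≤n i) (toℕ-punchIn-fromℕ< c≤n j))))

toℕ-punchIn-≢ : ∀ {n r} (r≤n : r < suc n) (i : Fin n) → toℕ (punchIn (fromℕ< r≤n) i) ≢ r
toℕ-punchIn-≢ r≤n i eq =
  punchInᵢ≢i (fromℕ< r≤n) i (toℕ-injective (trans eq (sym (toℕ-fromℕ< r≤n))))

detℕ-row : ∀ n F {r c} → r < suc n → c < suc n → (∀ j → j < suc n → j ≢ c → F r j ≡ 0ℤ) →
  detℕ (suc n) F ≡ sgn r * (sgn c * (F r c * detℕ n (minorℕ r c F)))
detℕ-row n F r≤n c≤n row≡0 = trans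
  (det-row (toMatrix (suc n) F) (fromℕ< r≤n) (fromℕ< c≤n) λ j →
    trans (cong (λ r → F r _) (toℕ-fromℕ< r≤n)) (row≡0 _ (toℕ<n (punchIn (fromℕ< c≤n) j)) (toℕ-punchIn-≢ c≤n j)))
  (cofactorTerm-fromℕ< n F r≤n c≤n)

detℕ-column : ∀ n F {r c} → r < suc n → c < suc n → (∀ i → i < suc n → i ≢ r → F i c ≡ 0ℤ) →
  detℕ (suc n) F ≡ sgn r * (sgn c * (F r c * detℕ n (minorℕ r c F)))
detℕ-column n F r≤n c≤n column≡0 = trans
  (det-column (toMatrix (suc n) F) (fromℕ< r≤n) (fromℕ< c≤n) λ i →
    trans (cong (F _) (toℕ-fromℕ< c≤n)) (column≡0 _ (toℕ<n (punchIn (fromℕ< r≤n) i)) (toℕ-punchIn-≢ r≤n i)))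
  (cofactorTerm-fromℕ< n F r≤n c≤n)

-- Peeling off an antidiagonal corner.

-- Since neither index exceeds `s`, a sum of `s + m` forces both to be at least `m`, and each is
-- shifted by one.
skip-+-skip⁺ : ∀ m s {i j} → i < suc s → j < suc s →
  i ℕ.+ j ≡ s ℕ.+ m → skip m i ℕ.+ skip m j ≡ suc (suc (s ℕ.+ m))
skip-+-skip⁺ m s {i} {j} (s≤s i≤s) (s≤s j≤s) i+j≡ = begin
  skip m i ℕ.+ skip m j  ≡⟨ cong₂ ℕ._+_ (skip-≥ m≤i) (skip-≥ m≤j) ⟩
  suc i ℕ.+ suc j        ≡⟨ cong suc (ℕ.+-suc i j) ⟩
  suc (suc (i ℕ.+ j))    ≡⟨ cong (2 ℕ.+_) i+j≡ ⟩
  suc (suc (s ℕ.+ m))    ∎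
  where
  open ≡-Reasoning
  m≤j : m ≤ j
  m≤j = ℕ.+-cancelˡ-≤ s m j (ℕ.≤-trans (ℕ.≤-reflexive (sym i+j≡)) (ℕ.+-monoˡ-≤ j i≤s))
  m≤i : m ≤ i
  m≤i = ℕ.+-cancelˡ-≤ s m i
    (ℕ.≤-trans (ℕ.≤-reflexive (trans (sym i+j≡) (ℕ.+-comm i j))) (ℕ.+-monoˡ-≤ i j≤s))

-- An index below `m` stays below `m` while the other reaches at most `suc s`, so the sum would be
-- too small; hence both indices are shifted.
skip-+-skip⁻ : ∀ m s {i j} → i < suc s → j < suc s →
  skip m i ℕ.+ skip m j ≡ suc (suc (s ℕ.+ m)) → i ℕ.+ j ≡ s ℕ.+ m
skip-+-skip⁻ m s {i} {j} i≤s j≤s eq = ℕ.suc-injective (ℕ.suc-injective (begin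
  suc (suc (i ℕ.+ j))    ≡⟨ cong suc (ℕ.+-suc i j) ⟨
  suc i ℕ.+ suc j        ≡⟨ cong₂ ℕ._+_ (skip-≥ m≤i) (skip-≥ m≤j) ⟨
  skip m i ℕ.+ skip m j  ≡⟨ eq ⟩
  suc (suc (s ℕ.+ m))    ∎))
  where
  open ≡-Reasoning
  small : ∀ {x y} → x < m → y < suc s → skip m x ℕ.+ skip m y < suc (suc (s ℕ.+ m))
  small {x} {y} x<m y≤s = ℕ.<-≤-trans
    (ℕ.+-mono-<-≤ (subst (_< m) (sym (skip-< x<m)) x<m) (ℕ.≤-trans (skip≤suc m y) y≤s))
    (ℕ.≤-trans (ℕ.≤-reflexive (ℕ.+-comm m (suc s))) (ℕ.n≤1+n _))
  m≤i : m ≤ i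
  m≤i = ℕ.≮⇒≥ λ i<m → ℕ.<-irrefl eq (small i<m j≤s)
  m≤j : m ≤ j
  m≤j = ℕ.≮⇒≥ λ j<m → ℕ.<-irrefl (trans (ℕ.+-comm (skip m j) (skip m i)) eq) (small j<m i≤s)

-- Induction on `q`: the last row and the last column have their only 1 at index `m`. Expanding
-- along both deletes index `m` and the last index from rows and columns alike, so the minor has the
-- same shape for `q - 1`.
det-antidiagonal-corner : ∀ q m F →
  (∀ i j → i < suc (q ℕ.* 2 ℕ.+ m) → j < suc (q ℕ.* 2 ℕ.+ m) →
    i ℕ.+ j ≡ q ℕ.* 2 ℕ.+ m ℕ.+ m → F i j ≡ 1ℤ) →
  (∀ i j → i < suc (q ℕ.* 2 ℕ.+ m) → j < suc (q ℕ.* 2 ℕ.+ m) →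
    q ℕ.+ m ≤ i ⊎ q ℕ.+ m ≤ j → i ℕ.+ j ≢ q ℕ.* 2 ℕ.+ m ℕ.+ m → F i j ≡ 0ℤ) →
  detℕ (suc (q ℕ.* 2 ℕ.+ m)) F ≡ sgn q * detℕ m F
det-antidiagonal-corner zero m F ones zeros = begin
  detℕ (suc m) F
    ≡⟨ detℕ-row m F ℕ.≤-refl ℕ.≤-refl
         (λ j j≤m j≢m → zeros m j ℕ.≤-refl j≤m (inj₁ ℕ.≤-refl) (j≢m ∘ ℕ.+-cancelˡ-≡ m j m)) ⟩
  sgn m * (sgn m * (F m m * detℕ m (minorℕ m m F)))
    ≡⟨ cong₂ (λ e d → sgn m * (sgn m * (e * d))) (ones m m ℕ.≤-refl ℕ.≤-refl refl)
         (detℕ-cong m λ i j i<m j<m → cong₂ F (skip-< i<m) (skip-< j<m)) ⟩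
  sgn m * (sgn m * (1ℤ * detℕ m F))
    ≡⟨ assoc (sgn m) (detℕ m F) ⟩
  sgn m * sgn m * detℕ m F
    ≡⟨ cong (_* detℕ m F) (sgn*sgn≡1 m) ⟩
  sgn zero * detℕ m F ∎
  where
  open ≡-Reasoning
  assoc : ∀ x d → x * (x * (1ℤ * d)) ≡ x * x * d
  assoc = solve-∀
det-antidiagonal-corner (suc q) m F ones zeros = begin
  detℕ (suc (suc (suc s))) F
    ≡⟨ detℕ-row (suc (suc s)) F ℕ.≤-refl m<3+s (λ j j<3+s j≢m →
         zeros (suc (suc s)) j ℕ.≤-refl j<3+s (inj₁ h≤2+s)
           (j≢m ∘ ℕ.+-cancelˡ-≡ (suc (suc s)) j m)) ⟩
  sgn (suc (suc s)) * (sgn m * (F (suc (suc s)) m * detℕ (suc (suc s)) G))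
    ≡⟨ cong₂ (λ e d → sgn (suc (suc s)) * (sgn m * (e * d)))
         (ones (suc (suc s)) m ℕ.≤-refl m<3+s refl)
         (trans (detℕ-column (suc s) G m<2+s ℕ.≤-refl G-column)
           (cong₂ (λ e d → sgn m * (sgn (suc s) * (e * d))) G-corner
             (trans (detℕ-cong (suc s) G-minor)
               (trans (det-antidiagonal-corner q m H H-ones H-zeros)
                 (cong (sgn q *_) (detℕ-cong m λ i j i<m j<m → cong₂ F (skip-< i<m) (skip-< j<m))))))) ⟩
  sgn (suc (suc s)) * (sgn m * (1ℤ * (sgn m * (sgn (suc s) * (1ℤ * (sgn q * detℕ m F))))))
    -- The column is expanded in a matrix of order one less, so its position is `suc s` against
    -- `suc (suc s)` for the row; this leaves a single factor -1.
    ≡⟨ collect (sgn s) (sgn m) (sgn q) (detℕ m F) ⟩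
  (sgn s * sgn s) * (sgn m * sgn m) * (sgn (suc q) * detℕ m F)
    ≡⟨ cong₂ (λ x y → x * y * (sgn (suc q) * detℕ m F)) (sgn*sgn≡1 s) (sgn*sgn≡1 m) ⟩
  1ℤ * 1ℤ * (sgn (suc q) * detℕ m F)
    ≡⟨ *-identityˡ _ ⟩
  sgn (suc q) * detℕ m F ∎
  where
  open ≡-Reasoning
  s = q ℕ.* 2 ℕ.+ m
  G = minorℕ (suc (suc s)) m F
  H = minorℕ m m F
  collect : ∀ s m q d →
    (-1ℤ * (-1ℤ * s)) * (m * (1ℤ * (m * ((-1ℤ * s) * (1ℤ * (q * d)))))) ≡ (s * s) * (m * m) * ((-1ℤ * q) * d)
  collect = solve-∀
  m≤s : m ≤ s
  m≤s = ℕ.m≤n+m m (q ℕ.* 2)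
  m<2+s : m < suc (suc s)
  m<2+s = s≤s (ℕ.m≤n⇒m≤1+n m≤s)
  m<3+s : m < suc (suc (suc s))
  m<3+s = ℕ.m≤n⇒m≤1+n m<2+s
  h≤2+s : suc q ℕ.+ m ≤ suc (suc s)
  h≤2+s = s≤s (ℕ.m≤n⇒m≤1+n (ℕ.+-monoˡ-≤ m (ℕ.m≤m*n q 2)))
  skip-m-1+s : skip m (suc s) ≡ suc (suc s)
  skip-m-1+s = skip-≥ (ℕ.m≤n⇒m≤1+n m≤s)
  G-corner : G m (suc s) ≡ 1ℤ
  G-corner = trans (cong₂ F (skip-< m<2+s) skip-m-1+s)
    (ones m (suc (suc s)) m<3+s ℕ.≤-refl (ℕ.+-comm m (suc (suc s))))
  G-column : ∀ i → i < suc (suc s) → i ≢ m → G i (suc s) ≡ 0ℤ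
  G-column i i<2+s i≢m = trans (cong₂ F (skip-< i<2+s) skip-m-1+s)
    (zeros i (suc (suc s)) (ℕ.m≤n⇒m≤1+n i<2+s) ℕ.≤-refl (inj₂ h≤2+s)
      (λ eq → i≢m (ℕ.+-cancelˡ-≡ (suc (suc s)) i m (trans (ℕ.+-comm (suc (suc s)) i) eq))))
  skip-bound : ∀ {i} → i < suc s → skip m i < suc (suc s)
  skip-bound i<1+s = s≤s (ℕ.≤-trans (skip≤suc m _) i<1+s)
  G-minor : ∀ i j → i < suc s → j < suc s → minorℕ m (suc s) G i j ≡ H i j
  G-minor i j i<1+s j<1+s = cong₂ F (skip-< (skip-bound i<1+s)) (cong (skip m) (skip-< j<1+s))
  H-ones : ∀ i j → i < suc s → j < suc s → i ℕ.+ j ≡ s ℕ.+ m → H i j ≡ 1ℤ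
  H-ones i j i<1+s j<1+s eq = ones (skip m i) (skip m j)
    (ℕ.m≤n⇒m≤1+n (skip-bound i<1+s)) (ℕ.m≤n⇒m≤1+n (skip-bound j<1+s)) (skip-+-skip⁺ m s i<1+s j<1+s eq)
  -- Such an index lies past the deleted `m` and moves up by one, matching the later start of the
  -- larger corner.
  late : ∀ {i} → q ℕ.+ m ≤ i → suc q ℕ.+ m ≤ skip m i
  late q+m≤i = ℕ.≤-trans (s≤s q+m≤i)
    (ℕ.≤-reflexive (sym (skip-≥ (ℕ.≤-trans (ℕ.m≤n+m m q) q+m≤i))))
  H-zeros : ∀ i j → i < suc s → j < suc s → q ℕ.+ m ≤ i ⊎ q ℕ.+ m ≤ j → i ℕ.+ j ≢ s ℕ.+ m → H i j ≡ 0ℤ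
  H-zeros i j i<1+s j<1+s q+m≤ neq = zeros (skip m i) (skip m j)
    (ℕ.m≤n⇒m≤1+n (skip-bound i<1+s)) (ℕ.m≤n⇒m≤1+n (skip-bound j<1+s)) (Sum.map late late q+m≤)
    (neq ∘ skip-+-skip⁻ m s i<1+s j<1+s)

-- The corner of the Hankel matrix.

A-special : ∀ {n} → IsSpecial n → A n ≡ 1ℤ
A-special {n} special = cong (if_then 1ℤ else 0ℤ) (dec-true (isSpecial? n) special)

A-notSpecial : ∀ {n} → ¬ IsSpecial n → A n ≡ 0ℤ
A-notSpecial {n} notSpecial = cong (if_then 1ℤ else 0ℤ) (dec-false (isSpecial? n) notSpecial)

2^-cancel-< : ∀ k l → 2 ℕ.^ k < 2 ℕ.^ l → k < l
2^-cancel-< k l 2^k<2^l = ℕ.≰⇒> λ l≤k → ℕ.<⇒≱ 2^k<2^l (ℕ.^-monoʳ-≤ 2 l≤k)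

-- For special `t`, `2 + t` is a power of two, and only one power lies strictly between `2 ^ k` and
-- `2 ^ (k + 2)`.
special-unique : ∀ k {t} → IsSpecial t → 2 ℕ.^ k < 2 ℕ.+ t → 2 ℕ.+ t < 2 ℕ.^ suc (suc k) → 2 ℕ.+ t ≡ 2 ℕ.^ suc k
special-unique k {t} (l , t≡) lower upper = trans 2+t≡ (cong (2 ℕ.^_) (ℕ.≤-antisym
  (ℕ.≤-pred (2^-cancel-< (suc l) (suc (suc k)) (subst (_< 2 ℕ.^ suc (suc k)) 2+t≡ upper)))
  (2^-cancel-< k (suc l) (subst (2 ℕ.^ k <_) 2+t≡ lower))))
  where
  2+t≡ : 2 ℕ.+ t ≡ 2 ℕ.^ suc l
  2+t≡ = trans (cong (2 ℕ.+_) t≡) (ℕ.m+[n∸m]≡n (ℕ.*-monoʳ-≤ 2 (ℕ.m^n>0 2 l)))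

-- If `i` or `j` is at least `q + m = 2 ^ k - 1`, then `2 + i + j` exceeds `2 ^ k`; as both are at
-- most `2q + m`, it stays below `4 (q + m + 1) = 2 ^ (k + 2)`. The one special sum in that range is
-- `2 ^ (k + 1) - 2 = 2q + 2m`.
D-reduce : ∀ k q m → suc q ℕ.+ m ≡ 2 ℕ.^ k → D (suc (q ℕ.* 2 ℕ.+ m)) ≡ sgn q * D m
D-reduce k q m 1+q+m≡2^k = det-antidiagonal-corner q m (λ i j → A (i ℕ.+ j))
  (λ i j _ _ i+j≡ → A-special (k , trans i+j≡ (sym (cong (ℕ._∸ 2) 2^[1+k]≡))))
  (λ i j i<n j<n late i+j≢ → A-notSpecial λ special → i+j≢ (ℕ.suc-injective (ℕ.suc-injective
    (trans (special-unique k special (lower late) (upper i<n j<n)) 2^[1+k]≡))))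
  where
  2^[1+k]≡ : 2 ℕ.^ suc k ≡ 2 ℕ.+ (q ℕ.* 2 ℕ.+ m ℕ.+ m)
  2^[1+k]≡ = trans (cong (2 ℕ.*_) (sym 1+q+m≡2^k)) (eq q m)
    where
    eq : ∀ q m → 2 ℕ.* (suc q ℕ.+ m) ≡ 2 ℕ.+ (q ℕ.* 2 ℕ.+ m ℕ.+ m)
    eq = ℕ.solve-∀
  lower : ∀ {i j} → q ℕ.+ m ≤ i ⊎ q ℕ.+ m ≤ j → 2 ℕ.^ k < 2 ℕ.+ (i ℕ.+ j)
  lower {i} {j} late = subst (_< 2 ℕ.+ (i ℕ.+ j)) 1+q+m≡2^k (s≤s (s≤s
    (Sum.[ (λ q+m≤i → ℕ.≤-trans q+m≤i (ℕ.m≤m+n i j)) , (λ q+m≤j → ℕ.≤-trans q+m≤j (ℕ.m≤n+m j i)) ] late)))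
  upper : ∀ {i j} → i < suc (q ℕ.* 2 ℕ.+ m) → j < suc (q ℕ.* 2 ℕ.+ m) → 2 ℕ.+ (i ℕ.+ j) < 2 ℕ.^ suc (suc k)
  upper {i} {j} (s≤s i≤) (s≤s j≤) = begin-strict
    2 ℕ.+ (i ℕ.+ j)
      ≤⟨ ℕ.+-monoʳ-≤ 2 (ℕ.+-mono-≤ i≤ j≤) ⟩
    2 ℕ.+ (q ℕ.* 2 ℕ.+ m ℕ.+ (q ℕ.* 2 ℕ.+ m))
      -- The added term is the exact gap up to `4 (q + m + 1)`.
      <⟨ ℕ.m<m+n _ {suc (suc (m ℕ.+ m))} (s≤s z≤n) ⟩
    2 ℕ.+ (q ℕ.* 2 ℕ.+ m ℕ.+ (q ℕ.* 2 ℕ.+ m)) ℕ.+ suc (suc (m ℕ.+ m))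
      ≡⟨ eq q m ⟩
    2 ℕ.* (2 ℕ.* (suc q ℕ.+ m))
      ≡⟨ cong (λ x → 2 ℕ.* (2 ℕ.* x)) 1+q+m≡2^k ⟩
    2 ℕ.^ suc (suc k) ∎
    where
    open ℕ.≤-Reasoning
    eq : ∀ q m → 2 ℕ.+ (q ℕ.* 2 ℕ.+ m ℕ.+ (q ℕ.* 2 ℕ.+ m)) ℕ.+ suc (suc (m ℕ.+ m)) ≡ 2 ℕ.* (2 ℕ.* (suc q ℕ.+ m))
    eq = ℕ.solve-∀

-- Writing a positive order in reducible form.

-- For index `n` the data amount to `2 ^ k ≤ n < 2 ^ (k + 1)`, with `q = n - 2 ^ k` and
-- `m = 2 ^ (k + 1) - 1 - n`.
data Reduction : ℕ → Set where
  reduction : ∀ k q m → suc q ℕ.+ m ≡ 2 ℕ.^ k → Reduction (suc (q ℕ.* 2 ℕ.+ m))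

reduce : ∀ n → Reduction (suc n)
reduce zero = reduction 0 0 0 refl
reduce (suc n) with reduce n
-- Here `m = 0` means that the order is `2 ^ (k + 1) - 1`; the next one is a power of two and opens
-- a new range with `q = 0`.
... | reduction k q zero    1+q≡2^k  = reduction (suc k) 0 (suc (q ℕ.* 2 ℕ.+ 0)) (trans (eq q) (cong (2 ℕ.*_) 1+q≡2^k))
  where
  eq : ∀ q → suc (suc (q ℕ.* 2 ℕ.+ 0)) ≡ 2 ℕ.* (suc q ℕ.+ 0)
  eq = ℕ.solve-∀
... | reduction k q (suc m) 1+q+m≡2^k = subst Reduction (cong suc (cong suc (sym (ℕ.+-suc (q ℕ.* 2) m))))
  (reduction k (suc q) m (trans (cong suc (sym (ℕ.+-suc q m))) 1+q+m≡2^k))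

-- Signs of binomial coefficients.

sgnC2 : ℕ → ℤ
sgnC2 n = sgn (n C 2)

sgnC2-suc : ∀ n → sgnC2 (suc n) ≡ sgn n * sgnC2 n
sgnC2-suc n = begin
  sgn (suc n C 2)             ≡⟨ cong sgn (nCk+nC[k+1]≡[n+1]C[k+1] n 1) ⟨
  sgn (n C 1 ℕ.+ n C 2)       ≡⟨ ^-distribˡ-+-* -1ℤ (n C 1) (n C 2) ⟩
  sgn (n C 1) * sgnC2 n       ≡⟨ cong (λ x → sgn x * sgnC2 n) (nC1≡n n) ⟩
  sgn n * sgnC2 n             ∎
  where open ≡-Reasoning

-- The difference of the two binomial coefficients is `2n + 1`, which is odd.
sgnC2-2+ : ∀ n → sgnC2 (suc (suc n)) ≡ -1ℤ * sgnC2 n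
sgnC2-2+ n = begin
  sgnC2 (suc (suc n))                ≡⟨ sgnC2-suc (suc n) ⟩
  sgn (suc n) * sgnC2 (suc n)        ≡⟨ cong (sgn (suc n) *_) (sgnC2-suc n) ⟩
  sgn (suc n) * (sgn n * sgnC2 n)    ≡⟨ assoc (sgn n) (sgnC2 n) ⟩
  (sgn n * sgn n) * (-1ℤ * sgnC2 n)  ≡⟨ cong (_* (-1ℤ * sgnC2 n)) (sgn*sgn≡1 n) ⟩
  1ℤ * (-1ℤ * sgnC2 n)               ≡⟨ *-identityˡ (-1ℤ * sgnC2 n) ⟩
  -1ℤ * sgnC2 n                      ∎
  where
  open ≡-Reasoning
  assoc : ∀ x c → (-1ℤ * x) * (x * c) ≡ (x * x) * (-1ℤ * c)
  assoc = solve-∀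

sgnC2-+ : ∀ q n → sgnC2 (q ℕ.* 2 ℕ.+ n) ≡ sgn q * sgnC2 n
sgnC2-+ zero    n = sym (*-identityˡ (sgnC2 n))
sgnC2-+ (suc q) n = trans (sgnC2-2+ (q ℕ.* 2 ℕ.+ n))
  (trans (cong (-1ℤ *_) (sgnC2-+ q n)) (sym (*-assoc -1ℤ (sgn q) (sgnC2 n))))

sgn-*2 : ∀ q → sgn (q ℕ.* 2) ≡ 1ℤ
sgn-*2 zero    = refl
sgn-*2 (suc q) rewrite sgn-*2 q = refl

-- The strong induction.

Claim : ℕ → Set
Claim n =
  (D (2 ℕ.* n) ≡ sgnC2 n * D n) ×
  (D (2 ℕ.* n ℕ.+ 1) ≡ sgnC2 (n ℕ.+ 1) * D n)

-- Parities cross: the even case for `n` rests on the odd case for `m`, and the odd case on the even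
-- one. Both then return from `D m` to `D n` by reducing `n` itself.
claim-reduction : ∀ {n} → Reduction n → (∀ {m} → m < n → Claim m) → Claim n
claim-reduction (reduction k q m 1+q+m≡2^k) ih with ih {m} (s≤s (ℕ.m≤n+m m (q ℕ.* 2)))
... | D[2m] , D[2m+1] = even , odd
  where
  open ≡-Reasoning
  n = suc (q ℕ.* 2 ℕ.+ m)
  cancel : ∀ c → sgn q * c * D n ≡ c * D m
  cancel c = begin
    sgn q * c * D n              ≡⟨ cong (sgn q * c *_) (D-reduce k q m 1+q+m≡2^k) ⟩
    sgn q * c * (sgn q * D m)    ≡⟨ shuffle (sgn q) c (D m) ⟩
    sgn q * sgn q * (c * D m)    ≡⟨ cong (_* (c * D m)) (sgn*sgn≡1 q) ⟩
    1ℤ * (c * D m)               ≡⟨ *-identityˡ (c * D m) ⟩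
    c * D m                      ∎
    where
    shuffle : ∀ x c d → x * c * (x * d) ≡ x * x * (c * d)
    shuffle = solve-∀
  even : D (2 ℕ.* n) ≡ sgnC2 n * D n
  even = begin
    D (2 ℕ.* n)
      ≡⟨ cong D (size q m) ⟩
    D (suc (q ℕ.* 2 ℕ.* 2 ℕ.+ (2 ℕ.* m ℕ.+ 1)))
      ≡⟨ D-reduce (suc k) (q ℕ.* 2) (2 ℕ.* m ℕ.+ 1) (trans (power q m) (cong (2 ℕ.*_) 1+q+m≡2^k)) ⟩
    sgn (q ℕ.* 2) * D (2 ℕ.* m ℕ.+ 1)
      ≡⟨ cong₂ _*_ (sgn-*2 q) D[2m+1] ⟩
    1ℤ * (sgnC2 (m ℕ.+ 1) * D m)
      ≡⟨ *-identityˡ _ ⟩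
    sgnC2 (m ℕ.+ 1) * D m
      ≡⟨ cancel (sgnC2 (m ℕ.+ 1)) ⟨
    sgn q * sgnC2 (m ℕ.+ 1) * D n
      -- The sign `sgn q` is what turns the binomial sign at `m + 1` into that at `2q + m + 1 = n`.
      ≡⟨ cong (_* D n) (sgnC2-+ q (m ℕ.+ 1)) ⟨
    sgnC2 (q ℕ.* 2 ℕ.+ (m ℕ.+ 1)) * D n
      ≡⟨ cong (λ x → sgnC2 x * D n) (index q m) ⟩
    sgnC2 n * D n ∎
    where
    size : ∀ q m → 2 ℕ.* suc (q ℕ.* 2 ℕ.+ m) ≡ suc (q ℕ.* 2 ℕ.* 2 ℕ.+ (2 ℕ.* m ℕ.+ 1))
    size = ℕ.solve-∀
    power : ∀ q m → suc (q ℕ.* 2) ℕ.+ (2 ℕ.* m ℕ.+ 1) ≡ 2 ℕ.* (suc q ℕ.+ m)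
    power = ℕ.solve-∀
    index : ∀ q m → q ℕ.* 2 ℕ.+ (m ℕ.+ 1) ≡ suc (q ℕ.* 2 ℕ.+ m)
    index = ℕ.solve-∀
  odd : D (2 ℕ.* n ℕ.+ 1) ≡ sgnC2 (n ℕ.+ 1) * D n
  odd = begin
    D (2 ℕ.* n ℕ.+ 1)
      ≡⟨ cong D (size q m) ⟩
    D (suc (suc (q ℕ.* 2) ℕ.* 2 ℕ.+ 2 ℕ.* m))
      ≡⟨ D-reduce (suc k) (suc (q ℕ.* 2)) (2 ℕ.* m) (trans (power q m) (cong (2 ℕ.*_) 1+q+m≡2^k)) ⟩
    -1ℤ * sgn (q ℕ.* 2) * D (2 ℕ.* m)
      ≡⟨ cong₂ (λ x d → -1ℤ * x * d) (sgn-*2 q) D[2m] ⟩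
    -1ℤ * (sgnC2 m * D m)
      ≡⟨ *-assoc -1ℤ (sgnC2 m) (D m) ⟨
    -1ℤ * sgnC2 m * D m
      ≡⟨ cong (_* D m) (sgnC2-2+ m) ⟨
    sgnC2 (suc (suc m)) * D m
      ≡⟨ cancel (sgnC2 (suc (suc m))) ⟨
    sgn q * sgnC2 (suc (suc m)) * D n
      ≡⟨ cong (_* D n) (sgnC2-+ q (suc (suc m))) ⟨
    sgnC2 (q ℕ.* 2 ℕ.+ suc (suc m)) * D n
      ≡⟨ cong (λ x → sgnC2 x * D n) (index q m) ⟩
    sgnC2 (n ℕ.+ 1) * D n ∎
    where
    size : ∀ q m → 2 ℕ.* suc (q ℕ.* 2 ℕ.+ m) ℕ.+ 1 ≡ suc (suc (q ℕ.* 2) ℕ.* 2 ℕ.+ 2 ℕ.* m)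
    size = ℕ.solve-∀
    power : ∀ q m → suc (suc (q ℕ.* 2)) ℕ.+ 2 ℕ.* m ≡ 2 ℕ.* (suc q ℕ.+ m)
    power = ℕ.solve-∀
    index : ∀ q m → q ℕ.* 2 ℕ.+ suc (suc m) ≡ suc (q ℕ.* 2 ℕ.+ m) ℕ.+ 1
    index = ℕ.solve-∀

theorem2p5 : ∀ (n : ℕ) →
    (D (2 ℕ.* n) ≡ -1ℤ ^ (n C 2) * D n) ×
    (D (2 ℕ.* n ℕ.+ 1) ≡ -1ℤ ^ ((n ℕ.+ 1) C 2) * D n)
theorem2p5 = <-rec Claim λ where
  -- All terms evaluate to 1; in particular `D 1 = A 0 = 1`, as 0 is special with `k = 0`.
  zero    _  → refl , refl
  (suc n) ih → claim-reduction (reduce n) ih
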